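{- Let $\mathbb{F}$ be a field of characteristic zero. Let $\mathbb{V}=\mathbb{W}_1\oplus\cdots\oplus\mathbb{W}_k$ be a vector space over $\mathbb{F}$ that is the direct sum of $n$-dimensional subspaces $\mathbb{W}_i$, $i=1,\ldots,k$. Let $E_1,\ldots,E_m$ be subsets of $\mathbb{V}$ such that, for each $i=1,\ldots,m$: (a) $E_i$ contains, with the exception of the zero vector, an $n_{E_i}$-dimensional subspace of $\mathbb{V}$ (that is, there is a subspace $U_i$ of $\mathbb{V}$ with $\dim U_i=n_{E_i}$ and $U_i\setminus\{0\}\subseteq E_i$), where $\lceil n/2\rceil+1\le n_{E_i}\le n$; and (b) $E_i\subseteq \mathbb{W}_{i^*}$ for some $1\le i^*\le k$. Let $S=\{1,\ldots,m\}$ and let $\mathcal{I}$ be the set of subsets $I=\{i_1,\ldots,i_r\}$ of $S$ such that $\{E_{i_1},E_{i_2},\ldots,E_{i_r}\}$ forms a LISF. Then the ordered pair $(S,\mathcal{I})$ is a matroid.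
   Context: LISF: Let $\mathbb{V}$ be an $l$-dimensional vector space over a field $\mathbb{F}$. A family $\{C_i : i=1,\ldots,n\}$ ($n\le l$) of non-empty subsets $C_i\subseteq\mathbb{V}$ is called a linearly independent set family (LISF) if every selection of $n$ vectors $v_i\in C_i$ ($i=1,\ldots,n$) is linearly independent in $\mathbb{V}$. (In this definition $n$ is just the number of members of the family.) Families are understood as indexed by their labels: sets with different labels count as different members even if they are equal as sets, and the vectors $v_1,\ldots,v_n$ are linearly independent as an indexed family. The empty family is regarded as a LISF. Matroid: a pair $(S,\mathcal{I})$ with $S$ a finite set and $\mathcal{I}$ a collection of subsets of $S$ such that (I.1) $\emptyset\in\mathcal{I}$; (I.2) if $I\in\mathcal{I}$ and $I'\subseteq I$ then $I'\in\mathcal{I}$; (I.3) if $I_1,I_2\in\mathcal{I}$ and $|I_1|<|I_2|$ then there is $e\in I_2\setminus I_1$ with $I_1\cup\{e\}\in\mathcal{I}$. -}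

module Defs where

open import Algebra.Bundles using (CommutativeRing)
open import Algebra.Module.Bundles using (Module)
import Algebra.Definitions
import Algebra.Definitions.RawMonoid
open import Data.Fin.Base using (Fin)
open import Data.Fin.Subset as Subset using (Subset)
open import Data.Nat.Base using (ℕ; _≤_; _<_)
open import Data.Product.Base using (∃-syntax; _×_)
open import Data.Vec.Functional using (Vector)
open import Function.Bundles using (_⇔_)
open import Function.Definitions using (Injective)
open import Level using (_⊔_; suc)
open import Relation.Binary.Definitions using (_Respects_)
open import Relation.Binary.PropositionalEquality using (_≡_)
open import Relation.Nullary.Negation using (¬_)
open import Relation.Unary as Unary using (Pred; Satisfiable)

-- Equality in a field is not assumed decidable, and invertibility is required
-- of every element that is merely not equal to zero; classically this is the
-- usual notion of field.
record IsField {c ℓ} (R : CommutativeRing c ℓ) : Set (c ⊔ ℓ) where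
  open CommutativeRing R
  open Algebra.Definitions _≈_ using (Invertible)
  field
    1≉0        : ¬ (1# ≈ 0#)
    invertible : ∀ x → ¬ (x ≈ 0#) → Invertible 1# _*_ x

CharacteristicZero : ∀ {c ℓ} → CommutativeRing c ℓ → Set ℓ
CharacteristicZero R = ∀ n → 1 ≤ n → ¬ (n · 1# ≈ 0#)
  where
  open CommutativeRing R
  open Algebra.Definitions.RawMonoid +-rawMonoid using () renaming (_×_ to _·_)

module LinearAlgebra {c ℓ} (F : CommutativeRing c ℓ)
                     {v ℓv} (V : Module F v ℓv) where

  open CommutativeRing F using (Carrier; _≈_; 0#)
  open Module V
  open Algebra.Definitions.RawMonoid +ᴹ-rawMonoid public using () renaming (sum to sumᴹ)

  linComb : ∀ {r} → Vector Carrier r → Vector Carrierᴹ r → Carrierᴹ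
  linComb a x = sumᴹ (λ j → a j *ₗ x j)

  LinearlyIndependent : ∀ {r} → Vector Carrierᴹ r → Set (c ⊔ ℓ ⊔ ℓv)
  LinearlyIndependent x = ∀ a → linComb a x ≈ᴹ 0ᴹ → ∀ j → a j ≈ 0#

  record IsSubspace {u} (U : Pred Carrierᴹ u) : Set (c ⊔ v ⊔ ℓv ⊔ u) where
    field
      resp      : U Respects _≈ᴹ_
      0-closed  : U 0ᴹ
      +-closed  : ∀ {x y} → U x → U y → U (x +ᴹ y)
      *ₗ-closed : ∀ a {x} → U x → U (a *ₗ x)

  record IsBasis {u} (U : Pred Carrierᴹ u) {d} (b : Vector Carrierᴹ d)
                 : Set (c ⊔ ℓ ⊔ v ⊔ ℓv ⊔ u) where
    field
      members     : ∀ j → U (b j)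
      independent : LinearlyIndependent b
      spanning    : ∀ x → U x → ∃[ a ] x ≈ᴹ linComb a b

  HasDimension : ∀ {u} → Pred Carrierᴹ u → ℕ → Set (c ⊔ ℓ ⊔ v ⊔ ℓv ⊔ u)
  HasDimension U d = ∃[ b ] IsBasis U {d} b

  -- The whole space is the internal direct sum of the subspaces W i.
  record IsDirectSum {w} {k} (W : Fin k → Pred Carrierᴹ w)
                     : Set (c ⊔ v ⊔ ℓv ⊔ w) where
    field
      subspaces  : ∀ i → IsSubspace (W i)
      decompose  : ∀ x → ∃[ y ] (∀ i → W i (y i)) × x ≈ᴹ sumᴹ y
      uniqueness : ∀ (y z : Vector Carrierᴹ k) →
                   (∀ i → W i (y i)) → (∀ i → W i (z i)) →
                   sumᴹ y ≈ᴹ sumᴹ z → ∀ i → y i ≈ᴹ z i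

  ContainsPuncturedSubspace : ∀ {e} u → Pred Carrierᴹ e → ℕ →
                              Set (c ⊔ ℓ ⊔ v ⊔ ℓv ⊔ e ⊔ suc u)
  ContainsPuncturedSubspace u E d =
    ∃[ U ] IsSubspace {u} U × HasDimension U d ×
           (∀ x → U x → ¬ (x ≈ᴹ 0ᴹ) → E x)

  -- The ambient space is required to be finite-dimensional, of some dimension
  -- l that bounds the number of members of the family.
  record LISF {e} {r} (C : Fin r → Pred Carrierᴹ e)
              : Set (c ⊔ ℓ ⊔ v ⊔ ℓv ⊔ e) where
    field
      bounded     : ∃[ l ] HasDimension Unary.U l × r ≤ l
      nonempty    : ∀ j → Satisfiable (C j)
      independent : ∀ (x : Vector Carrierᴹ r) → (∀ j → C j (x j)) →
                    LinearlyIndependent x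

-- i lists the elements of I, each exactly once.
Enumerates : ∀ {m r} → (Fin r → Fin m) → Subset m → Set
Enumerates i I = Injective _≡_ _≡_ i × (∀ s → s Subset.∈ I ⇔ (∃[ j ] i j ≡ s))

module _ {c ℓ} (F : CommutativeRing c ℓ) {v ℓv} (V : Module F v ℓv) where
  open Module V using (Carrierᴹ)
  open LinearAlgebra F V

  -- The collection of those I = {i₁,…,iᵣ} for which {E i₁,…,E iᵣ} is a LISF.
  LISFCollection : ∀ {e} {m} → (Fin m → Pred Carrierᴹ e) →
                   Pred (Subset m) (c ⊔ ℓ ⊔ v ⊔ ℓv ⊔ e)
  LISFCollection {m = m} E I =
    ∃[ r ] ∃[ i ] Enumerates {m} {r} i I × LISF (λ j → E (i j))

-- Matroids on the ground set {1,…,m}.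
record IsMatroid {m} {p} (𝓘 : Pred (Subset m) p) : Set p where
  open Subset using (_∈_; _∉_; _⊆_; _∪_; ⁅_⁆; ∣_∣) renaming (⊥ to ∅)
  field
    empty      : 𝓘 ∅
    hereditary : ∀ {I I′} → 𝓘 I → I′ ⊆ I → 𝓘 I′
    exchange   : ∀ {I₁ I₂} → 𝓘 I₁ → 𝓘 I₂ → ∣ I₁ ∣ < ∣ I₂ ∣ →
                 ∃[ s ] s ∈ I₂ × s ∉ I₁ × 𝓘 (I₁ ∪ ⁅ s ⁆)

{-# OPTIONS --safe #-}

-- Members of a LISF lie in pairwise different summands: if E and E′ both lie in
-- the n-dimensional Wᵢ, the subspaces that they contain up to 0 have dimensions
-- adding up to more than n, so they share a nonzero vector, which may be selected
-- from both sets. Conversely, vectors from different summands are independent as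
-- soon as each of them is. So 𝓘 is a partition matroid with loops, a loop being a
-- set that contains 0, and exchange is the pigeonhole principle.
--
-- Since equality in the field is not decidable, the shared vector is only obtained
-- under a double negation; this is enough because it serves to refute.
module Submission where

open import Defs
open import Algebra.Bundles using (CommutativeMonoid; CommutativeRing)
open import Algebra.Module.Bundles using (Module)
import Algebra.Module.Properties
import Algebra.Properties.CommutativeMonoid.Sum
import Algebra.Properties.Ring
import Algebra.Properties.Semiring.Sum
open import Data.Bool.Base using (if_then_else_)
open import Data.Fin.Base using (Fin; zero; suc; _↑ˡ_; _↑ʳ_; combine; join; punchIn; remQuot; splitAt)
open import Data.Fin.Properties
  using ( _≟_; any?; ¬∀⟶∃¬; injective⇒≤; sequence; suc-injective
        ; join-splitAt; remQuot-combine; combine-surjective)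
open import Data.Fin.Subset as Subset using (Subset; inside; outside; _∈_; _∪_; ⁅_⁆; ∣_∣)
open import Data.Fin.Subset.Properties
  using (p⊆q⇒∣p∣≤∣q∣; x∈p∪q⁻; x∈⁅y⁆⇒x≡y; ∉⊥; ∣⊥∣≡0; ∪-identityʳ)
open import Data.Nat.Base using (ℕ; zero; suc; _+_; _*_; _≤_; _<_; s≤s; z≤n; ⌈_/2⌉)
import Data.Nat.Properties as ℕ
open import Data.Product.Base using (∃-syntax; _×_; _,_; proj₁; proj₂)
open import Data.Sum.Base as Sum using (_⊎_; inj₁; inj₂)
open import Data.Vec.Base using (_∷_; []; here; there)
open import Data.Vec.Functional using (Vector; insertAt; removeAt; _++_)
  renaming (_∷_ to _∷ᶠ_; [] to []ᶠ)
open import Data.Vec.Functional.Properties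
  using (insertAt-lookup; insertAt-punchIn; lookup-++ˡ; lookup-++ʳ)
open import Effect.Monad using (RawMonad)
open import Function.Base using (_∘_)
open import Function.Bundles using (Equivalence; mk⇔)
open import Function.Definitions using (Injective)
open import Level using (Level; _⊔_)
open import Relation.Binary.Definitions using (_Respects_)
open import Relation.Binary.PropositionalEquality as ≡ using (_≡_; _≢_)
import Relation.Binary.Reasoning.Setoid
open import Relation.Nullary.Decidable using (Dec; yes; no; does)
open import Relation.Nullary.Negation using (¬_; contradiction; ¬¬-Monad)
open import Relation.Unary as Unary using (Pred; Satisfiable; _⊆_)

-- Listing and counting the elements of a finite subset.

enum : ∀ {m} (I : Subset m) → Fin ∣ I ∣ → Fin m
enum (outside ∷ I) j       = suc (enum I j)
enum (inside  ∷ I) zero    = zero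
enum (inside  ∷ I) (suc j) = suc (enum I j)

enum-injective : ∀ {m} (I : Subset m) → Injective _≡_ _≡_ (enum I)
enum-injective (outside ∷ I)                 eq = enum-injective I (suc-injective eq)
enum-injective (inside  ∷ I) {zero}  {zero}  eq = ≡.refl
enum-injective (inside  ∷ I) {suc _} {suc _} eq =
  ≡.cong suc (enum-injective I (suc-injective eq))

enum-∈ : ∀ {m} (I : Subset m) j → enum I j ∈ I
enum-∈ (outside ∷ I) j       = there (enum-∈ I j)
enum-∈ (inside  ∷ I) zero    = here
enum-∈ (inside  ∷ I) (suc j) = there (enum-∈ I j)

enum-surjective : ∀ {m} (I : Subset m) {s} → s ∈ I → ∃[ j ] enum I j ≡ s
enum-surjective (outside ∷ I) (there s∈I) with enum-surjective I s∈I
... | j , eq = j , ≡.cong suc eq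
enum-surjective (inside  ∷ I) here        = zero , ≡.refl
enum-surjective (inside  ∷ I) (there s∈I) with enum-surjective I s∈I
... | j , eq = suc j , ≡.cong suc eq

enum-enumerates : ∀ {m} (I : Subset m) → Enumerates (enum I) I
enum-enumerates I =
  enum-injective I , λ s → mk⇔ (enum-surjective I) λ { (j , ≡.refl) → enum-∈ I j }

-- Choosing for each element of `I` a position at which `i` lists it is injective, because `i`
-- recovers the element. This turns the bound on the length of a LISF into a bound on `∣ I ∣`.
enumerates⇒∣I∣≤ : ∀ {m r} {i : Fin r → Fin m} {I} → Enumerates i I → ∣ I ∣ ≤ r
enumerates⇒∣I∣≤ {i = i} {I} (_ , ∈⇔) = injective⇒≤ {f = proj₁ ∘ index} λ {j} {j′} eq →
  enum-injective I (≡.trans (≡.sym (proj₂ (index j))) (≡.trans (≡.cong i eq) (proj₂ (index j′))))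
  where
  index : ∀ j → ∃[ j′ ] i j′ ≡ enum I j
  index j = Equivalence.to (∈⇔ (enum I j)) (enum-∈ I j)

∣I∪⁅s⁆∣≤ : ∀ {m} (I : Subset m) s → ∣ I ∪ ⁅ s ⁆ ∣ ≤ suc ∣ I ∣
∣I∪⁅s⁆∣≤ (outside ∷ I) zero    rewrite ∪-identityʳ I = ℕ.≤-refl
∣I∪⁅s⁆∣≤ (inside  ∷ I) zero    rewrite ∪-identityʳ I = ℕ.n≤1+n _
∣I∪⁅s⁆∣≤ (outside ∷ I) (suc s) = ∣I∪⁅s⁆∣≤ I s
∣I∪⁅s⁆∣≤ (inside  ∷ I) (suc s) = s≤s (∣I∪⁅s⁆∣≤ I s)

-- Twice `⌈ n /2⌉` is already at least `n`, and the added ones make the inequality strict.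
n<d+d′ : ∀ n {d d′} → ⌈ n /2⌉ + 1 ≤ d → ⌈ n /2⌉ + 1 ≤ d′ → n < d + d′
n<d+d′ n {d} {d′} h h′ = begin-strict
  n                             ≡⟨ ℕ.⌊n/2⌋+⌈n/2⌉≡n n ⟨
  _ + ⌈ n /2⌉                   ≤⟨ ℕ.+-monoˡ-≤ _ (ℕ.⌊n/2⌋≤⌈n/2⌉ n) ⟩
  ⌈ n /2⌉ + ⌈ n /2⌉             <⟨ ℕ.+-mono-< half<half+1 half<half+1 ⟩
  (⌈ n /2⌉ + 1) + (⌈ n /2⌉ + 1) ≤⟨ ℕ.+-mono-≤ h h′ ⟩
  d + d′                        ∎
  where
  open ℕ.≤-Reasoning
  half<half+1 : ⌈ n /2⌉ < ⌈ n /2⌉ + 1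
  half<half+1 = ℕ.m<m+n ⌈ n /2⌉ (s≤s z≤n)

-- Finite sums in a commutative monoid.

module Sums {c ℓ} (M : CommutativeMonoid c ℓ) where
  open CommutativeMonoid M
  open Algebra.Properties.CommutativeMonoid.Sum M public
  open Relation.Binary.Reasoning.Setoid setoid

  sum-++ : ∀ d {d′} (g : Vector Carrier (d + d′)) →
           sum g ≈ sum (λ j → g (j ↑ˡ d′)) ∙ sum (λ j → g (d ↑ʳ j))
  sum-++ zero    g = sym (identityˡ _)
  sum-++ (suc d) g = trans (∙-congˡ (sum-++ d (g ∘ suc))) (sym (assoc _ _ _))

  sum-combine : ∀ k {n} (g : Vector Carrier (k * n)) →
                sum g ≈ sum (λ i → sum (λ j → g (combine {k} {n} i j)))
  sum-combine zero    g = refl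
  sum-combine (suc k) {n} g = trans (sum-++ n g) (∙-congˡ (sum-combine k (λ t → g (n ↑ʳ t))))

  sum-zero : ∀ {n} {g : Vector Carrier n} → (∀ j → g j ≈ ε) → sum g ≈ ε
  sum-zero {n} g≈ε = trans (sum-cong-≋ g≈ε) (sum-replicate-zero n)

  sum-single : ∀ {n} (q : Fin n) x → sum (λ p → if does (q ≟ p) then x else ε) ≈ x
  sum-single {suc n} zero    x = trans (∙-congˡ (sum-zero {n} λ _ → refl)) (identityʳ x)
  -- `does (suc q ≟ suc p)` computes to `does (q ≟ p)`, so the tail is literally the sum for `q`.
  sum-single (suc q) x = trans (identityˡ _) (sum-single q x)

  -- The sums of g over the fibres of f.
  push : ∀ {r k} → (Fin r → Fin k) → Vector Carrier r → Vector Carrier k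
  push f g p = sum (λ j → if does (f j ≟ p) then g j else ε)

  -- After exchanging the two sums, each `g j` is counted in exactly one fibre, the one over `f j`.
  sum-push : ∀ {r k} (f : Fin r → Fin k) g → sum (push f g) ≈ sum g
  sum-push f g = trans
    (∑-comm (λ p j → if does (f j ≟ p) then g j else ε))
    (sum-cong-≋ λ j → sum-single (f j) (g j))

  push-injective : ∀ {r k} {f : Fin r → Fin k} → Injective _≡_ _≡_ f →
                   ∀ g j → push f g (f j) ≈ g j
  push-injective {f = f} f-inj g j = trans (sum-cong-≋ only-j) (sum-single j (g j))
    where
    only-j : ∀ j′ → (if does (f j′ ≟ f j) then g j′ else ε) ≈ (if does (j ≟ j′) then g j else ε)
    only-j j′ with f j′ ≟ f j | j ≟ j′
    ... | yes _  | yes j≡j′ = reflexive (≡.cong g (≡.sym j≡j′))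
    ... | yes eq | no j≢j′  = contradiction (≡.sym (f-inj eq)) j≢j′
    ... | no neq | yes j≡j′ = contradiction (≡.cong f (≡.sym j≡j′)) neq
    ... | no _   | no _     = refl

-- Gaussian elimination for underdetermined homogeneous systems.

module HomogeneousSystem {c ℓ} (F : CommutativeRing c ℓ) (isField : IsField F) where
  open CommutativeRing F hiding (zero) renaming (_+_ to _+ᶠ_; _*_ to _*ᶠ_)
  open IsField isField
  open Algebra.Properties.Ring ring using (-1*x≈-x; -‿distribʳ-*)
  open Algebra.Properties.Semiring.Sum semiring
  open Sums +-commutativeMonoid using (sum-zero)
  open Relation.Binary.Reasoning.Setoid setoid

  infix 7 _·_

  _·_ : ∀ {r} → Vector Carrier r → Vector Carrier r → Carrier
  x · y = sum (λ j → x j *ᶠ y j)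

  ·-insertAt : ∀ {r} (x : Vector Carrier (suc r)) b p e →
               x · insertAt b p e ≈ x p *ᶠ e +ᶠ removeAt x p · b
  ·-insertAt x b p e = trans
    (sum-remove {i = p} (λ j → x j *ᶠ insertAt b p e j))
    (+-cong (*-congˡ (reflexive (insertAt-lookup b p e)))
            (sum-cong-≋ λ j → *-congˡ (reflexive (insertAt-punchIn b p e j))))

  ·-linearˡ : ∀ {r} (x y b : Vector Carrier r) s →
              (λ j → x j +ᶠ s *ᶠ y j) · b ≈ x · b +ᶠ s *ᶠ (y · b)
  ·-linearˡ {r} x y b s = begin
    sum (λ j → (x j +ᶠ s *ᶠ y j) *ᶠ b j)
      ≈⟨ sum-cong-≋ {r} (λ j → trans (distribʳ _ _ _) (+-congˡ (*-assoc _ _ _))) ⟩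
    sum (λ j → x j *ᶠ b j +ᶠ s *ᶠ (y j *ᶠ b j))
      ≈⟨ ∑-distrib-+ {r} _ _ ⟩
    x · b +ᶠ sum (λ j → s *ᶠ (y j *ᶠ b j))
      ≈⟨ +-congˡ (sym (*-distribˡ-sum {r} s _)) ⟩
    x · b +ᶠ s *ᶠ (y · b) ∎

  NontrivialSolution : ∀ {n r} → (Fin n → Vector Carrier r) → Set (c ⊔ ℓ)
  NontrivialSolution A = ∃[ a ] (∀ i → A i · a ≈ 0#) × ∃[ j ] ¬ (a j ≈ 0#)

  -- Here `q` is meant to be the inverse of the pivot `A zero p`. A multiple of row zero is added to
  -- each later row to clear column `p`, which is then deleted.
  eliminate : ∀ {n r} (A : Fin (suc n) → Vector Carrier (suc r)) p → Carrier →
              Fin n → Vector Carrier r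
  eliminate A p q i j =
    removeAt (A (suc i)) p j +ᶠ (A (suc i) p *ᶠ (- q)) *ᶠ removeAt (A zero) p j

  backSubstitute : ∀ {n r} (A : Fin (suc n) → Vector Carrier (suc r)) p q → A zero p *ᶠ q ≈ 1# →
                   NontrivialSolution (eliminate A p q) → NontrivialSolution A
  backSubstitute A p q pq≈1 (b , solves , j , bj≉0) = a , solves′ , punchIn p j , nonzero
    where
    Y = removeAt (A zero) p · b
    -- The value of the pivot unknown that makes row zero vanish.
    e = (- q) *ᶠ Y
    a = insertAt b p e

    nonzero : ¬ (a (punchIn p j) ≈ 0#)
    nonzero = bj≉0 ∘ trans (reflexive (≡.sym (insertAt-punchIn b p e j)))

    solves′ : ∀ i → A i · a ≈ 0#
    solves′ zero = begin
      A zero · a                           ≈⟨ ·-insertAt (A zero) b p e ⟩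
      A zero p *ᶠ ((- q) *ᶠ Y) +ᶠ Y        ≈⟨ +-congʳ (sym (*-assoc _ _ _)) ⟩
      (A zero p *ᶠ (- q)) *ᶠ Y +ᶠ Y        ≈⟨ +-congʳ (*-congʳ (sym (-‿distribʳ-* _ _))) ⟩
      (- (A zero p *ᶠ q)) *ᶠ Y +ᶠ Y        ≈⟨ +-congʳ (*-congʳ (-‿cong pq≈1)) ⟩
      (- 1#) *ᶠ Y +ᶠ Y                     ≈⟨ +-congʳ (-1*x≈-x Y) ⟩
      - Y +ᶠ Y                             ≈⟨ -‿inverseˡ Y ⟩
      0#                                   ∎
    solves′ (suc i) = begin
      A (suc i) · a                                               ≈⟨ ·-insertAt (A (suc i)) b p e ⟩
      A (suc i) p *ᶠ ((- q) *ᶠ Y) +ᶠ removeAt (A (suc i)) p · b   ≈⟨ +-comm _ _ ⟩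
      removeAt (A (suc i)) p · b +ᶠ A (suc i) p *ᶠ ((- q) *ᶠ Y)   ≈⟨ +-congˡ (sym (*-assoc _ _ _)) ⟩
      removeAt (A (suc i)) p · b +ᶠ (A (suc i) p *ᶠ (- q)) *ᶠ Y   ≈⟨ sym (·-linearˡ _ _ b _) ⟩
      eliminate A p q i · b                                       ≈⟨ solves i ⟩
      0#                                                          ∎

  dropZeroRow : ∀ {n r} (A : Fin (suc n) → Vector Carrier r) → (∀ j → A zero j ≈ 0#) →
                NontrivialSolution (A ∘ suc) → NontrivialSolution A
  dropZeroRow A row≈0 (a , solves , nonzero) = a , solves′ , nonzero
    where
    solves′ : ∀ i → A i · a ≈ 0#
    solves′ zero    = sum-zero λ j → trans (*-congʳ (row≈0 j)) (zeroˡ _)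
    solves′ (suc i) = solves i

  -- Induction on the number of equations. A pivot cannot be searched for without decidable
  -- equality, but under a double negation one may argue as if row zero either had a pivot or were
  -- zero.
  underdetermined⇒nontrivialSolution :
    ∀ {n r} → n < r → (A : Fin n → Vector Carrier r) → ¬ ¬ NontrivialSolution A
  underdetermined⇒nontrivialSolution {zero} {suc r} _ A none =
    -- With no equations every vector is a solution, and `n < r` leaves an unknown to carry a
    -- nonzero entry.
    none ((λ _ → 1#) , (λ ()) , zero , 1≉0)
  underdetermined⇒nontrivialSolution {suc n} {suc r} (s≤s n<r) A none =
    -- A nonzero entry of row zero would give a solution by elimination, so each entry is zero up to
    -- double negation; `sequence` merges these finitely many double negations into one.
    sequence (RawMonad.rawApplicative ¬¬-Monad) no-pivot λ row≈0 →
    underdetermined⇒nontrivialSolution (ℕ.m<n⇒m<1+n n<r) (A ∘ suc) (none ∘ dropZeroRow A row≈0)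
    where
    no-pivot : ∀ p → ¬ ¬ (A zero p ≈ 0#)
    no-pivot p p≉0 with invertible (A zero p) p≉0
    ... | q , _ , pq≈1 =
      underdetermined⇒nontrivialSolution n<r (eliminate A p q) (none ∘ backSubstitute A p q pq≈1)

-- Linear combinations and subspaces.

module Combinations {c ℓ} (F : CommutativeRing c ℓ) {v ℓv} (V : Module F v ℓv) where
  open CommutativeRing F
    using ( Carrier; _≈_; 0#; 1#; -_; sym; trans
          ; +-commutativeMonoid; -‿inverseˡ; -‿inverseʳ)
    renaming (_*_ to _*ᶠ_; _+_ to _+ᶠ_)
  open Module V
  open Algebra.Module.Properties V using (x≈0⇒x*y≈0; y≈0⇒x*y≈0; inverseˡ-uniqueᴹ)
  open LinearAlgebra F V
  private
    module S = Sums +-commutativeMonoid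
    module Sᴹ = Sums +ᴹ-commutativeMonoid
  open Relation.Binary.Reasoning.Setoid ≈ᴹ-setoid

  *ₗ-distribˡ-sum : ∀ {r} a (x : Vector Carrierᴹ r) → a *ₗ sumᴹ x ≈ᴹ sumᴹ (λ j → a *ₗ x j)
  *ₗ-distribˡ-sum {zero}  a x = *ₗ-zeroʳ a
  *ₗ-distribˡ-sum {suc r} a x =
    ≈ᴹ-trans (*ₗ-distribˡ a _ _) (+ᴹ-congˡ (*ₗ-distribˡ-sum a (x ∘ suc)))

  *ₗ-distribʳ-sum : ∀ {r} (a : Vector Carrier r) x → S.sum a *ₗ x ≈ᴹ sumᴹ (λ j → a j *ₗ x)
  *ₗ-distribʳ-sum {zero}  a x = *ₗ-zeroˡ x
  *ₗ-distribʳ-sum {suc r} a x =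
    ≈ᴹ-trans (*ₗ-distribʳ x _ _) (+ᴹ-congˡ (*ₗ-distribʳ-sum (a ∘ suc) x))

  linComb-++ : ∀ {d d′} a (x : Vector Carrierᴹ d) (y : Vector Carrierᴹ d′) →
               linComb a (x ++ y) ≈ᴹ linComb (λ j → a (j ↑ˡ d′)) x +ᴹ linComb (λ j → a (d ↑ʳ j)) y
  linComb-++ {d} {d′} a x y = ≈ᴹ-trans
    (Sᴹ.sum-++ d (λ t → a t *ₗ (x ++ y) t))
    (+ᴹ-cong (Sᴹ.sum-cong-≋ λ j → *ₗ-congˡ (≈ᴹ-reflexive (lookup-++ˡ x y j)))
             (Sᴹ.sum-cong-≋ λ j → *ₗ-congˡ (≈ᴹ-reflexive (lookup-++ʳ x y j))))

  -- The factors are ordered so that the coefficient of `y i` is the left-hand side of the `i`-th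
  -- equation of a homogeneous system in the unknowns `a`.
  linComb-linComb : ∀ {r n} a (A : Fin r → Vector Carrier n) (y : Vector Carrierᴹ n) →
                    linComb a (λ j → linComb (A j) y) ≈ᴹ
                    linComb (λ i → S.sum (λ j → A j i *ᶠ a j)) y
  linComb-linComb {r} {n} a A y = begin
    sumᴹ (λ j → a j *ₗ sumᴹ (λ i → A j i *ₗ y i))
      ≈⟨ Sᴹ.sum-cong-≋ (λ j → *ₗ-distribˡ-sum {n} (a j) _) ⟩
    sumᴹ (λ j → sumᴹ (λ i → a j *ₗ A j i *ₗ y i))
      ≈⟨ Sᴹ.∑-comm (λ j i → a j *ₗ A j i *ₗ y i) ⟩
    sumᴹ (λ i → sumᴹ (λ j → a j *ₗ A j i *ₗ y i))
      ≈⟨ Sᴹ.sum-cong-≋ {n} (λ i → Sᴹ.sum-cong-≋ {r} λ j →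
           ≈ᴹ-trans (*ₗ-comm _ _ _) (≈ᴹ-sym (*ₗ-assoc _ _ _))) ⟩
    sumᴹ (λ i → sumᴹ (λ j → (A j i *ᶠ a j) *ₗ y i))
      ≈⟨ Sᴹ.sum-cong-≋ (λ i → ≈ᴹ-sym (*ₗ-distribʳ-sum (λ j → A j i *ᶠ a j) (y i))) ⟩
    linComb (λ i → S.sum (λ j → A j i *ᶠ a j)) y ∎

  sum-closed : ∀ {w} {W : Pred Carrierᴹ w} → IsSubspace W →
               ∀ {r} (x : Vector Carrierᴹ r) → (∀ j → W (x j)) → W (sumᴹ x)
  sum-closed W-sub {zero}  x x∈W = IsSubspace.0-closed W-sub
  sum-closed W-sub {suc r} x x∈W =
    IsSubspace.+-closed W-sub (x∈W zero) (sum-closed W-sub (x ∘ suc) (x∈W ∘ suc))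

  linComb-closed : ∀ {w} {W : Pred Carrierᴹ w} → IsSubspace W →
                   ∀ {r} a (x : Vector Carrierᴹ r) → (∀ j → W (x j)) → W (linComb a x)
  linComb-closed W-sub a x x∈W =
    sum-closed W-sub _ λ j → IsSubspace.*ₗ-closed W-sub (a j) (x∈W j)

  -x≈-1*x : ∀ x → -ᴹ x ≈ᴹ (- 1#) *ₗ x
  -x≈-1*x x = ≈ᴹ-sym (inverseˡ-uniqueᴹ _ _ (begin
    (- 1#) *ₗ x +ᴹ x         ≈⟨ +ᴹ-congˡ (≈ᴹ-sym (*ₗ-identityˡ x)) ⟩
    (- 1#) *ₗ x +ᴹ 1# *ₗ x   ≈⟨ ≈ᴹ-sym (*ₗ-distribʳ x _ _) ⟩
    (- 1# +ᶠ 1#) *ₗ x        ≈⟨ x≈0⇒x*y≈0 (-‿inverseˡ 1#) ⟩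
    0ᴹ                       ∎))

  neg-closed : ∀ {w} {W : Pred Carrierᴹ w} → IsSubspace W → ∀ {x} → W x → W (-ᴹ x)
  neg-closed W-sub {x} x∈W =
    IsSubspace.resp W-sub (≈ᴹ-sym (-x≈-1*x x)) (IsSubspace.*ₗ-closed W-sub (- 1#) x∈W)

  -- Complete x by arbitrary members of the other sets, and extend the coefficients by zero.
  independent-reindex :
    ∀ {e r r′} {C : Fin r → Pred Carrierᴹ e} {f : Fin r′ → Fin r} → Injective _≡_ _≡_ f →
    (∀ i → Satisfiable (C i)) →
    (∀ (x : Vector Carrierᴹ r) → (∀ i → C i (x i)) → LinearlyIndependent x) →
    ∀ (x : Vector Carrierᴹ r′) → (∀ j → C (f j) (x j)) → LinearlyIndependent x
  independent-reindex {r = r} {r′} {C} {f} f-inj nonempty independent x x∈C a ax≈0 j =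
    trans (sym (S.push-injective f-inj a j))
          (independent x̂ (λ i → choose-∈ i (f⁻¹ i)) (S.push f a) âx̂≈0 (f j))
    where
    f⁻¹ : ∀ i → Dec (∃[ j ] f j ≡ i)
    f⁻¹ i = any? (λ j → f j ≟ i)

    choose : ∀ i → Dec (∃[ j ] f j ≡ i) → Carrierᴹ
    choose i (yes (j , _)) = x j
    choose i (no _)        = proj₁ (nonempty i)

    choose-∈ : ∀ i d → C i (choose i d)
    choose-∈ i (yes (j , ≡.refl)) = x∈C j
    choose-∈ i (no _)             = proj₂ (nonempty i)

    -- The search may return its own preimage of `i`; injectivity of `f` identifies it with `j`.
    choose-image : ∀ {i} j → f j ≡ i → ∀ d → choose i d ≡ x j
    choose-image j fj≡i (yes (j′ , fj′≡i)) = ≡.cong x (f-inj (≡.trans fj′≡i (≡.sym fj≡i)))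
    choose-image j fj≡i (no ∄j)            = contradiction (j , fj≡i) ∄j

    x̂ : Vector Carrierᴹ r
    x̂ i = choose i (f⁻¹ i)

    summand : ∀ i j → (if does (f j ≟ i) then a j else 0#) *ₗ x̂ i ≈ᴹ
                      (if does (f j ≟ i) then a j *ₗ x j else 0ᴹ)
    summand i j with f j ≟ i
    ... | yes fj≡i = *ₗ-congˡ (≈ᴹ-reflexive (choose-image j fj≡i (f⁻¹ i)))
    ... | no _     = *ₗ-zeroˡ _

    âx̂≈0 : linComb (S.push f a) x̂ ≈ᴹ 0ᴹ
    âx̂≈0 = begin
      linComb (S.push f a) x̂
        ≈⟨ Sᴹ.sum-cong-≋ (λ i → ≈ᴹ-trans
             (*ₗ-distribʳ-sum {r′} _ (x̂ i)) (Sᴹ.sum-cong-≋ (summand i))) ⟩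
      sumᴹ (Sᴹ.push f (λ j → a j *ₗ x j))
        ≈⟨ Sᴹ.sum-push f _ ⟩
      linComb a x
        ≈⟨ ax≈0 ⟩
      0ᴹ ∎

  -- Bases and independence in a direct sum.

  -- Bases of the summands, concatenated along `combine`, form a basis of the whole space. This
  -- supplies the finite dimension that even the empty LISF requires.
  directSum-finite : ∀ {w n k} {W : Fin k → Pred Carrierᴹ w} → IsDirectSum W →
                     (∀ i → HasDimension (W i) n) → HasDimension Unary.U (k * n)
  directSum-finite {n = n} {k} {W} W-sum W-dim = b , record
    { members     = λ _ → _
    ; independent = independent
    ; spanning    = λ x _ → spanning x
    }
    where
    open IsDirectSum W-sum
    basis : ∀ i → IsBasis (W i) (proj₁ (W-dim i))
    basis i = proj₂ (W-dim i)

    b : Vector Carrierᴹ (k * n)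
    b t = proj₁ (W-dim (proj₁ (remQuot {k} n t))) (proj₂ (remQuot {k} n t))

    b-combine : ∀ i j → b (combine i j) ≡ proj₁ (W-dim i) j
    b-combine i j = ≡.cong (λ p → proj₁ (W-dim (proj₁ p)) (proj₂ p)) (remQuot-combine {k} i j)

    linComb-b : ∀ a → linComb a b ≈ᴹ
                      sumᴹ (λ i → linComb (λ j → a (combine i j)) (proj₁ (W-dim i)))
    linComb-b a = ≈ᴹ-trans (Sᴹ.sum-combine k (λ t → a t *ₗ b t))
      (Sᴹ.sum-cong-≋ λ i → Sᴹ.sum-cong-≋ λ j → *ₗ-congˡ (≈ᴹ-reflexive (b-combine i j)))

    independent : LinearlyIndependent b
    independent a ab≈0 t with combine-surjective {k} {n} t
    ... | i , j , ≡.refl = IsBasis.independent (basis i) (λ j′ → a (combine i j′)) component≈0 j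
      where
      component≈0 : linComb (λ j′ → a (combine i j′)) (proj₁ (W-dim i)) ≈ᴹ 0ᴹ
      -- The components and the zero family both decompose the zero vector, so they agree.
      component≈0 = uniqueness _ (λ _ → 0ᴹ)
        (λ i′ → linComb-closed (subspaces i′) _ _ (IsBasis.members (basis i′)))
        (λ i′ → IsSubspace.0-closed (subspaces i′))
        (≈ᴹ-trans (≈ᴹ-sym (linComb-b a)) (≈ᴹ-trans ab≈0 (≈ᴹ-sym (Sᴹ.sum-zero {k} λ _ → ≈ᴹ-refl))))
        i

    spanning : ∀ x → ∃[ a ] x ≈ᴹ linComb a b
    spanning x with decompose x
    ... | y , y∈W , x≈∑y = a , (begin
      x                                                              ≈⟨ x≈∑y ⟩
      sumᴹ y                                                         ≈⟨ Sᴹ.sum-cong-≋ y≈ ⟩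
      sumᴹ (λ i → linComb (λ j → a (combine i j)) (proj₁ (W-dim i))) ≈⟨ ≈ᴹ-sym (linComb-b a) ⟩
      linComb a b                                                    ∎)
      where
      coordinates : ∀ i → ∃[ a ] y i ≈ᴹ linComb a (proj₁ (W-dim i))
      coordinates i = IsBasis.spanning (basis i) (y i) (y∈W i)

      a : Vector Carrier (k * n)
      a t = proj₁ (coordinates (proj₁ (remQuot {k} n t))) (proj₂ (remQuot {k} n t))

      a-combine : ∀ i j → a (combine i j) ≡ proj₁ (coordinates i) j
      a-combine i j =
        ≡.cong (λ p → proj₁ (coordinates (proj₁ p)) (proj₂ p)) (remQuot-combine {k} i j)

      y≈ : ∀ i → y i ≈ᴹ linComb (λ j → a (combine i j)) (proj₁ (W-dim i))
      y≈ i = ≈ᴹ-trans (proj₂ (coordinates i))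
        (Sᴹ.sum-cong-≋ λ j → *ₗ-congʳ (CommutativeRing.reflexive F (≡.sym (a-combine i j))))

  -- Since `f` is injective, each component of the vanishing sum is a single term `a j *ₗ x j`, and
  -- it is zero by uniqueness. The condition on each vector is cancellation: from `x j` being
  -- nonzero, `a j ≈ 0#` would follow only up to double negation.
  distinctSummands⇒independent :
    ∀ {w k r} {W : Fin k → Pred Carrierᴹ w} → IsDirectSum W →
    {f : Fin r → Fin k} → Injective _≡_ _≡_ f →
    (x : Vector Carrierᴹ r) → (∀ j → W (f j) (x j)) →
    (∀ j a → a *ₗ x j ≈ᴹ 0ᴹ → a ≈ 0#) → LinearlyIndependent x
  distinctSummands⇒independent {k = k} {W = W} W-sum {f} f-inj x x∈W torsionFree a ax≈0 j =
    torsionFree j (a j) (≈ᴹ-trans (≈ᴹ-sym (Sᴹ.push-injective f-inj ax j)) (y≈0 (f j)))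
    where
    open IsDirectSum W-sum
    ax = λ j → a j *ₗ x j

    summand-∈ : ∀ p j → W p (if does (f j ≟ p) then ax j else 0ᴹ)
    summand-∈ p j with f j ≟ p
    ... | yes ≡.refl = IsSubspace.*ₗ-closed (subspaces p) (a j) (x∈W j)
    ... | no _       = IsSubspace.0-closed (subspaces p)

    y≈0 : ∀ p → Sᴹ.push f ax p ≈ᴹ 0ᴹ
    y≈0 = uniqueness (Sᴹ.push f ax) (λ _ → 0ᴹ)
      (λ p → sum-closed (subspaces p) _ (summand-∈ p))
      (λ p → IsSubspace.0-closed (subspaces p))
      (≈ᴹ-trans (Sᴹ.sum-push f ax) (≈ᴹ-trans ax≈0 (≈ᴹ-sym (Sᴹ.sum-zero {k} λ _ → ≈ᴹ-refl))))

  -- Consequences of being a LISF.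

  module _ {e r} {C : Fin r → Pred Carrierᴹ e} (lisf : LISF C) where
    open LISF lisf

    -- Independence of a one-member subfamily, which is the constructive way to say that no member
    -- contains zero.
    LISF⇒torsionFree : ∀ {j x a} → C j x → a *ₗ x ≈ᴹ 0ᴹ → a ≈ 0#
    LISF⇒torsionFree {j} {x} {a} x∈C ax≈0 =
      independent-reindex {f = λ (_ : Fin 1) → j} (λ { {zero} {zero} _ → ≡.refl })
        nonempty independent (λ _ → x) (λ _ → x∈C) (λ _ → a)
        (≈ᴹ-trans (+ᴹ-identityʳ _) ax≈0) zero

    -- A common vector could be selected from both sets, and the relation `x - x = 0` has the
    -- coefficient `1#`.
    LISF⇒disjoint : ¬ (1# ≈ 0#) → ∀ {j j′ x} → j ≢ j′ → C j x → ¬ C j′ x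
    LISF⇒disjoint 1≉0 {j} {j′} {x} j≢j′ x∈C x∈C′ =
      1≉0 (independent-reindex {f = pair} pair-injective nonempty independent
             (λ _ → x) (λ { zero → x∈C ; (suc zero) → x∈C′ })
             (1# ∷ᶠ - 1# ∷ᶠ []ᶠ) x-x≈0 zero)
      where
      pair : Fin 2 → Fin r
      pair = j ∷ᶠ j′ ∷ᶠ []ᶠ

      pair-injective : Injective _≡_ _≡_ pair
      pair-injective {zero}     {zero}     _  = ≡.refl
      pair-injective {zero}     {suc zero} eq = contradiction eq j≢j′
      pair-injective {suc zero} {zero}     eq = contradiction (≡.sym eq) j≢j′
      pair-injective {suc zero} {suc zero} _  = ≡.refl

      x-x≈0 : 1# *ₗ x +ᴹ ((- 1#) *ₗ x +ᴹ 0ᴹ) ≈ᴹ 0ᴹ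
      x-x≈0 = begin
        1# *ₗ x +ᴹ ((- 1#) *ₗ x +ᴹ 0ᴹ) ≈⟨ +ᴹ-congˡ (+ᴹ-identityʳ _) ⟩
        1# *ₗ x +ᴹ (- 1#) *ₗ x         ≈⟨ ≈ᴹ-sym (*ₗ-distribʳ x _ _) ⟩
        (1# +ᶠ - 1#) *ₗ x              ≈⟨ x≈0⇒x*y≈0 (-‿inverseʳ 1#) ⟩
        0ᴹ                             ∎

  -- Counting dimensions.

  module _ (isField : IsField F) where
    open IsField isField
    open HomogeneousSystem F isField

    -- Only nonzero vectors of a punctured subspace are known to lie in the set containing it; this
    -- fact puts the basis vectors there.
    independent⇒nonzero : ∀ {d} {b : Vector Carrierᴹ d} → LinearlyIndependent b →
                          ∀ j → ¬ (b j ≈ᴹ 0ᴹ)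
    independent⇒nonzero {b = b} b-ind j bj≈0 = 1≉0 (trans
      (sym (S.push-injective {f = λ (_ : Fin 1) → j} (λ { {zero} {zero} _ → ≡.refl })
             (λ _ → 1#) zero))
      (b-ind _ (Sᴹ.sum-zero vanishes) j))
      where
      -- This push is the j-th unit vector.
      vanishes : ∀ i → S.push {1} (λ _ → j) (λ _ → 1#) i *ₗ b i ≈ᴹ 0ᴹ
      vanishes i with j ≟ i
      ... | yes ≡.refl = y≈0⇒x*y≈0 bj≈0
      ... | no _       = x≈0⇒x*y≈0 (CommutativeRing.+-identityʳ F 0#)

    -- In coordinates with respect to `y`, a relation among the `x j` is a solution of `n`
    -- homogeneous equations in `r` unknowns.
    overspanned⇒dependent :
      ∀ {n r} → n < r → (y : Vector Carrierᴹ n) (x : Vector Carrierᴹ r) →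
      (∀ j → ∃[ a ] x j ≈ᴹ linComb a y) →
      ¬ ¬ (∃[ a ] linComb a x ≈ᴹ 0ᴹ × ∃[ j ] ¬ (a j ≈ 0#))
    overspanned⇒dependent n<r y x spans independent =
      underdetermined⇒nontrivialSolution n<r (λ i j → A j i) λ { (a , solves , nonzero) →
        independent (a , ax≈0 a solves , nonzero) }
      where
      A = proj₁ ∘ spans
      ax≈0 : ∀ a → (∀ i → S.sum (λ j → A j i *ᶠ a j) ≈ 0#) → linComb a x ≈ᴹ 0ᴹ
      ax≈0 a solves = begin
        linComb a x                               ≈⟨ Sᴹ.sum-cong-≋ (λ j → *ₗ-congˡ (proj₂ (spans j))) ⟩
        linComb a (λ j → linComb (A j) y)         ≈⟨ linComb-linComb a A y ⟩
        linComb (λ i → S.sum (λ j → A j i *ᶠ a j)) y ≈⟨ Sᴹ.sum-zero (λ i → x≈0⇒x*y≈0 (solves i)) ⟩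
        0ᴹ                                        ∎

    -- The two bases together have more than `n` vectors in the span of `y`, so they satisfy a
    -- nontrivial relation `z + z′ = 0` with `z` in `U` and `z′` in `U′`. Then `z = - z′` lies in
    -- both subspaces.
    puncturedSubspaces-meet :
      ∀ {e e′ w u n d d′} {E : Pred Carrierᴹ e} {E′ : Pred Carrierᴹ e′} {W : Pred Carrierᴹ w} →
      HasDimension W n → E ⊆ W → E′ ⊆ W →
      ContainsPuncturedSubspace u E d → ContainsPuncturedSubspace u E′ d′ →
      n < d + d′ → ¬ ¬ (∃[ x ] E x × E′ x)
    puncturedSubspaces-meet {d = d} {d′} (y , y-basis) E⊆W E′⊆W
      (U , U-sub , (b , b-basis) , U⊆E) (U′ , U′-sub , (b′ , b′-basis) , U′⊆E′) n<d+d′ disjoint =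
      overspanned⇒dependent n<d+d′ y (b ++ b′) spans meet
      where
      module B = IsBasis b-basis
      module B′ = IsBasis b′-basis

      spans : ∀ t → ∃[ a ] (b ++ b′) t ≈ᴹ linComb a y
      spans t with splitAt d t
      ... | inj₁ j = IsBasis.spanning y-basis (b j)
        (E⊆W (U⊆E (b j) (B.members j) (independent⇒nonzero B.independent j)))
      ... | inj₂ j = IsBasis.spanning y-basis (b′ j)
        (E′⊆W (U′⊆E′ (b′ j) (B′.members j) (independent⇒nonzero B′.independent j)))

      meet : ¬ (∃[ a ] linComb a (b ++ b′) ≈ᴹ 0ᴹ × ∃[ t ] ¬ (a t ≈ 0#))
      -- A nonzero `z` would be a common vector, while `z ≈ᴹ 0ᴹ` makes all coefficients zero, by
      -- independence of each basis.
      meet (a , ab≈0 , t , at≉0) = ¬z≉0 λ z≈0 → at≉0 (a≈0 z≈0)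
        where
        aˡ = λ j → a (j ↑ˡ d′)
        aʳ = λ j → a (d ↑ʳ j)
        z  = linComb aˡ b
        z′ = linComb aʳ b′

        z+z′≈0 : z +ᴹ z′ ≈ᴹ 0ᴹ
        z+z′≈0 = ≈ᴹ-trans (≈ᴹ-sym (linComb-++ a b b′)) ab≈0

        z∈U : U z
        z∈U = linComb-closed U-sub aˡ b B.members

        z∈U′ : U′ z
        z∈U′ = IsSubspace.resp U′-sub (≈ᴹ-sym (inverseˡ-uniqueᴹ _ _ z+z′≈0))
          (neg-closed U′-sub (linComb-closed U′-sub aʳ b′ B′.members))

        ¬z≉0 : ¬ ¬ (z ≈ᴹ 0ᴹ)
        ¬z≉0 z≉0 = disjoint (z , U⊆E z z∈U z≉0 , U′⊆E′ z z∈U′ z≉0)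

        a≈0 : z ≈ᴹ 0ᴹ → a t ≈ 0#
        a≈0 z≈0 = ≡.subst (λ t → a t ≈ 0#) (join-splitAt d d′ t)
                    (vanishes (splitAt d t))
          where
          z′≈0 : z′ ≈ᴹ 0ᴹ
          z′≈0 = ≈ᴹ-trans (≈ᴹ-sym (+ᴹ-identityˡ z′)) (≈ᴹ-trans (+ᴹ-congʳ (≈ᴹ-sym z≈0)) z+z′≈0)

          vanishes : ∀ s → a (join d d′ s) ≈ 0#
          vanishes (inj₁ j) = B.independent aˡ z≈0 j
          vanishes (inj₂ j) = B′.independent aʳ z′≈0 j

-- The matroid of the subfamilies that are LISFs.

theorem3p5 : ∀ {c ℓ v ℓv w e u : Level}
    (F : CommutativeRing c ℓ) → IsField F → CharacteristicZero F →
    (V : Module F v ℓv) →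
    (n k : ℕ) (W : Fin k → Pred (Module.Carrierᴹ V) w) →
    LinearAlgebra.IsDirectSum F V W → (∀ i → LinearAlgebra.HasDimension F V (W i) n) →
    (m : ℕ) (E : Fin m → Pred (Module.Carrierᴹ V) e) → (∀ i → E i Respects Module._≈ᴹ_ V) →
    (nE : Fin m → ℕ) →
    (∀ i → LinearAlgebra.ContainsPuncturedSubspace F V u (E i) (nE i)) →
    (∀ i → ⌈ n /2⌉ + 1 ≤ nE i × nE i ≤ n) →
    (∀ i → ∃[ i* ] E i ⊆ W i*) →
    IsMatroid (LISFCollection F V E)
theorem3p5 {c} {ℓ} {v} {ℓv} {e = e} F isField _ V n k W W-sum W-dim m E _ nE E⊇U nE-bounds E⊆W = record
  { empty      = transversal⇒LISF record
    -- No LISF is given here to provide a dimension, so it comes from the direct sum.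
    { finite      = k * n , directSum-finite W-sum W-dim , ≡.subst (_≤ k * n) (≡.sym (∣⊥∣≡0 m)) z≤n
    ; nonempty    = λ s∈∅ → contradiction s∈∅ ∉⊥
    ; torsionFree = λ s∈∅ → contradiction s∈∅ ∉⊥
    ; distinct    = λ s∈∅ → contradiction s∈∅ ∉⊥
    }
  ; hereditary = λ 𝓘I I′⊆I → transversal⇒LISF (hereditary (LISF⇒transversal 𝓘I) I′⊆I)
  ; exchange   = λ 𝓘I₁ 𝓘I₂ lt →
      let s , s∈I₂ , s∉I₁ , t = exchange (LISF⇒transversal 𝓘I₁) (LISF⇒transversal 𝓘I₂) lt
      in s , s∈I₂ , s∉I₁ , transversal⇒LISF t
  }
  where
  open CommutativeRing F using (_≈_; 0#)
  open Module V using (_*ₗ_; _≈ᴹ_; 0ᴹ)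
  open LinearAlgebra F V
  open Combinations F V

  summand : Fin m → Fin k
  summand s = proj₁ (E⊆W s)

  -- Membership in the collection, expressed through elements of `I` instead of an enumeration, so
  -- that passing to subsets and adding an element can be checked elementwise.
  record IsTransversal (I : Subset m) : Set (c ⊔ ℓ ⊔ v ⊔ ℓv ⊔ e) where
    field
      finite      : ∃[ l ] HasDimension Unary.U l × ∣ I ∣ ≤ l
      nonempty    : ∀ {s} → s ∈ I → Satisfiable (E s)
      torsionFree : ∀ {s x a} → s ∈ I → E s x → a *ₗ x ≈ᴹ 0ᴹ → a ≈ 0#
      distinct    : ∀ {s t} → s ∈ I → t ∈ I → summand s ≡ summand t → s ≡ t

  sameSummand⇒meet : ∀ s t → summand s ≡ summand t → ¬ ¬ (∃[ x ] E s x × E t x)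
  sameSummand⇒meet s t eq = puncturedSubspaces-meet isField (W-dim (summand s))
    (proj₂ (E⊆W s)) (λ {x} x∈E → ≡.subst (λ i → W i x) (≡.sym eq) (proj₂ (E⊆W t) x∈E))
    (E⊇U s) (E⊇U t) (n<d+d′ n (proj₁ (nE-bounds s)) (proj₁ (nE-bounds t)))

  LISF⇒transversal : ∀ {I} → LISFCollection F V E I → IsTransversal I
  LISF⇒transversal {I} (r , i , enumerates@(_ , ∈⇔) , lisf) = record
    { finite      = let l , dim , r≤l = LISF.bounded lisf
                    in l , dim , ℕ.≤-trans (enumerates⇒∣I∣≤ enumerates) r≤l
    ; nonempty    = λ s∈I → nonempty (index s∈I)
    ; torsionFree = λ s∈I → torsionFree (index s∈I)
    ; distinct    = λ s∈I t∈I → distinct (index s∈I) (index t∈I)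
    }
    where
    index : ∀ {s} → s ∈ I → ∃[ j ] i j ≡ s
    index {s} = Equivalence.to (∈⇔ s)

    nonempty : ∀ {s} → ∃[ j ] i j ≡ s → Satisfiable (E s)
    nonempty (j , ≡.refl) = LISF.nonempty lisf j

    torsionFree : ∀ {s x a} → ∃[ j ] i j ≡ s → E s x → a *ₗ x ≈ᴹ 0ᴹ → a ≈ 0#
    torsionFree (j , ≡.refl) = LISF⇒torsionFree lisf {j}

    distinct : ∀ {s t} → ∃[ j ] i j ≡ s → ∃[ j ] i j ≡ t → summand s ≡ summand t → s ≡ t
    distinct (j , ≡.refl) (j′ , ≡.refl) eq with j ≟ j′
    ... | yes j≡j′ = ≡.cong i j≡j′
    -- Disjointness denies any common vector, so its existence under a double negation is already
    -- contradictory.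
    ... | no j≢j′  = contradiction
      (λ { (x , x∈E , x∈E′) → LISF⇒disjoint lisf (IsField.1≉0 isField) j≢j′ x∈E x∈E′ })
      (sameSummand⇒meet (i j) (i j′) eq)

  transversal⇒LISF : ∀ {I} → IsTransversal I → LISFCollection F V E I
  transversal⇒LISF {I} transversal = ∣ I ∣ , enum I , enum-enumerates I , record
    { bounded     = finite
    ; nonempty    = λ j → nonempty (enum-∈ I j)
    ; independent = λ x x∈E → distinctSummands⇒independent W-sum
        (λ {j} {j′} eq → enum-injective I (distinct (enum-∈ I j) (enum-∈ I j′) eq))
        x (λ j → proj₂ (E⊆W (enum I j)) (x∈E j))
        (λ j a → torsionFree (enum-∈ I j) (x∈E j))
    }
    where open IsTransversal transversal

  hereditary : ∀ {I I′} → IsTransversal I → I′ Subset.⊆ I → IsTransversal I′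
  hereditary transversal I′⊆I = record
    { finite      = let l , dim , ∣I∣≤l = finite in l , dim , ℕ.≤-trans (p⊆q⇒∣p∣≤∣q∣ I′⊆I) ∣I∣≤l
    ; nonempty    = λ s∈I′ → nonempty (I′⊆I s∈I′)
    ; torsionFree = λ s∈I′ → torsionFree (I′⊆I s∈I′)
    ; distinct    = λ s∈I′ t∈I′ → distinct (I′⊆I s∈I′) (I′⊆I t∈I′)
    }
    where open IsTransversal transversal

  exchange : ∀ {I₁ I₂} → IsTransversal I₁ → IsTransversal I₂ → ∣ I₁ ∣ < ∣ I₂ ∣ →
             ∃[ s ] s ∈ I₂ × s Subset.∉ I₁ × IsTransversal (I₁ ∪ ⁅ s ⁆)
  exchange {I₁} {I₂} transversal₁ transversal₂ ∣I₁∣<∣I₂∣ = s , s∈I₂ , s∉I₁ , record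
    -- The dimension bound is that of `I₂`, as `∣ I₁ ∣ + 1` is at most `∣ I₂ ∣`.
    { finite      = let l , dim , ∣I₂∣≤l = T₂.finite
                    in l , dim , ℕ.≤-trans (∣I∪⁅s⁆∣≤ I₁ s) (ℕ.≤-trans ∣I₁∣<∣I₂∣ ∣I₂∣≤l)
    ; nonempty    = nonempty ∘ cases
    ; torsionFree = torsionFree ∘ cases
    ; distinct    = λ t∈ t′∈ → distinct (cases t∈) (cases t′∈)
    }
    where
    module T₁ = IsTransversal transversal₁
    module T₂ = IsTransversal transversal₂

    Used : Fin ∣ I₂ ∣ → Set
    Used j₂ = ∃[ j₁ ] summand (enum I₁ j₁) ≡ summand (enum I₂ j₂)

    -- Otherwise matching positions by their summands would inject `I₂` into `I₁`, since the
    -- summands of `I₂` are distinct.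
    notAllUsed : ¬ (∀ j₂ → Used j₂)
    notAllUsed used = ℕ.<⇒≱ ∣I₁∣<∣I₂∣ (injective⇒≤ {f = proj₁ ∘ used} λ {j} {j′} eq →
      enum-injective I₂ (T₂.distinct (enum-∈ I₂ j) (enum-∈ I₂ j′)
        (≡.trans (≡.sym (proj₂ (used j)))
          (≡.trans (≡.cong (summand ∘ enum I₁) eq) (proj₂ (used j′))))))

    -- Labels of summands have decidable equality, so an actual witness is found.
    unused : ∃[ j₂ ] ¬ Used j₂
    unused = ¬∀⟶∃¬ _ Used
      (λ j₂ → any? λ j₁ → summand (enum I₁ j₁) ≟ summand (enum I₂ j₂)) notAllUsed

    s = enum I₂ (proj₁ unused)

    s∈I₂ : s ∈ I₂
    s∈I₂ = enum-∈ I₂ (proj₁ unused)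

    fresh : ∀ {t} → t ∈ I₁ → summand t ≢ summand s
    fresh t∈I₁ eq with enum-surjective I₁ t∈I₁
    ... | j₁ , ≡.refl = proj₂ unused (j₁ , eq)

    s∉I₁ : s Subset.∉ I₁
    s∉I₁ s∈I₁ = fresh s∈I₁ ≡.refl

    cases : ∀ {t} → t ∈ I₁ ∪ ⁅ s ⁆ → t ∈ I₁ ⊎ t ≡ s
    cases t∈ = Sum.map₂ (x∈⁅y⁆⇒x≡y s) (x∈p∪q⁻ I₁ ⁅ s ⁆ t∈)

    nonempty : ∀ {t} → t ∈ I₁ ⊎ t ≡ s → Satisfiable (E t)
    nonempty (inj₁ t∈I₁)   = T₁.nonempty t∈I₁
    nonempty (inj₂ ≡.refl) = T₂.nonempty s∈I₂

    torsionFree : ∀ {t x a} → t ∈ I₁ ⊎ t ≡ s → E t x → a *ₗ x ≈ᴹ 0ᴹ → a ≈ 0#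
    torsionFree (inj₁ t∈I₁)   = T₁.torsionFree t∈I₁
    torsionFree (inj₂ ≡.refl) = T₂.torsionFree s∈I₂

    distinct : ∀ {t t′} → t ∈ I₁ ⊎ t ≡ s → t′ ∈ I₁ ⊎ t′ ≡ s → summand t ≡ summand t′ → t ≡ t′
    distinct (inj₁ t∈I₁)   (inj₁ t′∈I₁)  eq = T₁.distinct t∈I₁ t′∈I₁ eq
    distinct (inj₁ t∈I₁)   (inj₂ ≡.refl) eq = contradiction eq (fresh t∈I₁)
    distinct (inj₂ ≡.refl) (inj₁ t′∈I₁)  eq = contradiction (≡.sym eq) (fresh t′∈I₁)
    distinct (inj₂ ≡.refl) (inj₂ ≡.refl) eq = ≡.refl
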